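{- Let $D$ be a quasi-transitive oriented graph. Then there is a vertex $v$ of $D$ such that $|N_D^+(v)|\le |N_D^{++}(v)|$.
   Context: All digraphs are finite, have a non-empty vertex set, and have no loops or multiple arcs. An oriented graph is a digraph with no directed cycle of length two. A digraph $D$ is quasi-transitive if for every pair $xy$, $yz$ of arcs of $D$ with $x\neq z$, the vertices $x$ and $z$ are adjacent, i.e. at least one of the arcs $xz$, $zx$ is in $D$. For a vertex $x$ of $D$, $N_D^+(x)$ denotes the set of out-neighbours of $x$ in $D$ (the vertices $y$ such that $xy$ is an arc of $D$), and the second out-neighbourhood of $x$ is $N_D^{++}(x)=\left(\bigcup_{u\in N_D^+(x)}N_D^+(u)\right)\setminus N_D^+(x)$. -}

module Defs where

open import Level using (0ℓ)
open import Data.Nat.Base using (ℕ)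
open import Data.Fin.Base using (Fin)
open import Data.Fin.Subset using (Subset; ⋃; _─_)
open import Data.List.Base using (allFin; filter; map)
open import Data.Sum.Base using (_⊎_)
open import Data.Vec.Base using (tabulate)
open import Relation.Binary.Core using (Rel)
open import Relation.Binary.Definitions using (Asymmetric; Decidable; Irreflexive)
open import Relation.Binary.PropositionalEquality using (_≡_; _≢_)
open import Relation.Nullary.Decidable using (does)

-- Only the inhabitation of Arc x y matters, never the number of its proofs,
-- so there are no multiple arcs. Non-emptiness of the vertex set is not part
-- of the record: it is a separate hypothesis NonZero n.
record Digraph (n : ℕ) : Set₁ where
  field
    Arc     : Rel (Fin n) 0ℓ
    arc?    : Decidable Arc
    no-loop : Irreflexive _≡_ Arc

  Adjacent : Rel (Fin n) 0ℓ
  Adjacent x y = Arc x y ⊎ Arc y x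

  N⁺ : Fin n → Subset n
  N⁺ x = tabulate (λ y → does (arc? x y))

  -- The list that is mapped over enumerates the out-neighbours of x.
  N⁺⁺ : Fin n → Subset n
  N⁺⁺ x = ⋃ (map N⁺ (filter (arc? x) (allFin n))) ─ N⁺ x

module _ {n : ℕ} (D : Digraph n) where
  open Digraph D

  -- Asymmetry excludes directed 2-cycles (and loops, already excluded).
  Oriented : Set
  Oriented = Asymmetric Arc

  QuasiTransitive : Set
  QuasiTransitive = ∀ {x y z} → Arc x y → Arc y z → x ≢ z → Adjacent x z

{-# OPTIONS --safe #-}

-- The median-order proof of Havet and Thomassé for tournaments. List the
-- vertices so as to maximise the number of backward arcs; then in every
-- interval the first vertex has at most as many out- as in-neighbours. Let f be
-- the first vertex of the whole list, and call v bad if v → f and v is not a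
-- second out-neighbour of f. Quasi-transitivity along v → f → x makes a bad v
-- adjacent to every out-neighbour x of f, and x → v is excluded, so v dominates
-- N⁺ f; likewise every in-neighbour of v is an in-neighbour of f. Hence, on the
-- stretch B of non-bad vertices following a vertex v that is f or bad,
-- |N⁺ f ∩ B| ≤ |N⁺ v ∩ B| ≤ |N⁻ v ∩ B| ≤ |N⁺⁺ f ∩ B|. The bad vertices and f are
-- not in N⁺ f, so summing over these stretches bounds |N⁺ f|.
module Submission where

open import Defs
open import Level using (0ℓ)
open import Data.Bool.Base using (true; false)
open import Data.Nat.Base using (ℕ; zero; suc; NonZero; _≤_; _<_; _+_; _*_; z≤n; s≤s)
open import Data.Nat.Properties
open import Data.Nat.Tactic.RingSolver using (solve-∀)
open import Data.Fin.Base using (Fin; zero; suc)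
open import Data.Fin.Properties using (any?)
open import Data.Fin.Subset using (Subset; inside; outside; ∣_∣; _∈_; _∉_; ⋃)
open import Data.Fin.Subset.Properties
  using (_∈?_; x∈p∪q⁺; x∈p∧x∉q⇒x∈p─q)
open import Data.List.Base using (List; []; _∷_; [_]; _++_; length; filter; map; allFin)
open import Data.List.Properties
  using (filter-++; filter-reject; length-filter; length-++; length-tabulate; map-tabulate;
         ++-assoc; ++-identityʳ)
open import Data.List.Membership.Propositional using () renaming (_∈_ to _∈ˡ_)
open import Data.List.Membership.Propositional.Properties using (∈-map⁺; ∈-filter⁺; ∈-allFin)
open import Data.List.Relation.Unary.All using (All; []; _∷_)
import Data.List.Relation.Unary.All as All
open import Data.List.Relation.Unary.All.Properties using () renaming (++⁺ to All-++⁺)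
open import Data.List.Relation.Unary.Any using (here; there)
open import Data.List.Relation.Binary.Permutation.Propositional
  using (_↭_; ↭-refl; ↭-sym; ↭-trans)
open import Data.List.Relation.Binary.Permutation.Propositional.Properties
  using (filter-↭; ↭-length; shift; ++⁺ˡ)
import Data.Vec.Base as Vec
open import Data.Vec.Properties using (lookup∘tabulate; []=⇒lookup; lookup⇒[]=)
open import Data.Product.Base using (∃-syntax; _×_; _,_; proj₁)
open import Data.Sum.Base using (inj₁; inj₂)
open import Data.Empty using (⊥)
open import Function.Base using (_∘_; id)
open import Relation.Binary.PropositionalEquality hiding ([_])
open import Relation.Nullary.Decidable
  using (yes; no; does; dec-true; decidable-stable; ¬?; _×-dec_)
open import Relation.Nullary.Negation using (¬_; contradiction)
open import Relation.Unary using (Pred; Decidable)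

-- Counting list entries by a decidable predicate.

module _ {A : Set} {P : Pred A 0ℓ} (P? : Decidable P) where

  cnt : List A → ℕ
  cnt = length ∘ filter P?

  cnt-++ : ∀ xs ys → cnt (xs ++ ys) ≡ cnt xs + cnt ys
  cnt-++ xs ys = trans (cong length (filter-++ P? xs ys)) (length-++ (filter P? xs))

  cnt-↭ : ∀ {xs ys} → xs ↭ ys → cnt xs ≡ cnt ys
  cnt-↭ = ↭-length ∘ filter-↭ P?

  cnt-reject : ∀ {x} xs → ¬ P x → cnt (x ∷ xs) ≡ cnt xs
  cnt-reject _ ¬p = cong length (filter-reject P? ¬p)

  cnt-≤-∷ : ∀ x xs → cnt xs ≤ cnt (x ∷ xs)
  cnt-≤-∷ x xs = subst (cnt xs ≤_) (sym (cnt-++ [ x ] xs)) (m≤n+m _ _)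

cnt-map : ∀ {A B : Set} {P : Pred A 0ℓ} {Q : Pred B 0ℓ} (P? : Decidable P) (Q? : Decidable Q)
          (f : A → B) → (∀ x → does (Q? (f x)) ≡ does (P? x)) →
          ∀ xs → cnt Q? (map f xs) ≡ cnt P? xs
cnt-map P? Q? f eq [] = refl
cnt-map P? Q? f eq (x ∷ xs) with does (Q? (f x)) | does (P? x) | eq x
... | true  | true  | _ = cong suc (cnt-map P? Q? f eq xs)
... | false | false | _ = cnt-map P? Q? f eq xs

cnt-mono : ∀ {A : Set} {P Q : Pred A 0ℓ} (P? : Decidable P) (Q? : Decidable Q) {xs} →
           All (λ x → P x → Q x) xs → cnt P? xs ≤ cnt Q? xs
cnt-mono P? Q? [] = z≤n
cnt-mono P? Q? {x ∷ xs} (p⇒q ∷ ps) with P? x | Q? x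
... | yes p | yes _ = s≤s (cnt-mono P? Q? ps)
... | yes p | no ¬q = contradiction (p⇒q p) ¬q
... | no _  | yes _ = m≤n⇒m≤1+n (cnt-mono P? Q? ps)
... | no _  | no _  = cnt-mono P? Q? ps

-- Moves cardinalities to counts along a list, where the enumeration may be permuted.
∣p∣≡cnt-∈ : ∀ {n} (p : Subset n) → ∣ p ∣ ≡ cnt (_∈? p) (allFin n)
∣p∣≡cnt-∈ Vec.[] = refl
∣p∣≡cnt-∈ {suc n} (s Vec.∷ p) =
  trans (head+tail s) (cong (λ xs → cnt (_∈? (s Vec.∷ p)) (zero ∷ xs)) (map-tabulate id suc))
  where
  tail : ∀ s → cnt (_∈? (s Vec.∷ p)) (map suc (allFin n)) ≡ ∣ p ∣
  tail s = trans (cnt-map (_∈? p) (_∈? (s Vec.∷ p)) suc (λ _ → refl) (allFin n)) (sym (∣p∣≡cnt-∈ p))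
  head+tail : ∀ s → ∣ s Vec.∷ p ∣ ≡ cnt (_∈? (s Vec.∷ p)) (zero ∷ map suc (allFin n))
  head+tail inside  = cong suc (sym (tail inside))
  head+tail outside = sym (tail outside)

x∈⋃⁺ : ∀ {n} {x : Fin n} {p : Subset n} {ps} → p ∈ˡ ps → x ∈ p → x ∈ ⋃ ps
x∈⋃⁺ (here refl)  x∈p = x∈p∪q⁺ (inj₁ x∈p)
x∈⋃⁺ (there p∈ps) x∈p = x∈p∪q⁺ (inj₂ (x∈⋃⁺ p∈ps x∈p))

module _ {n : ℕ} (D : Digraph n) where
  open Digraph D

  arcTo? : ∀ x → Decidable (λ y → Arc y x)
  arcTo? x y = arc? y x

  ∈N⁺⁺ : ∀ {x y} → Arc x y → y ∈ N⁺ x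
  ∈N⁺⁺ {x} {y} xy = lookup⇒[]= y _ (trans (lookup∘tabulate _ y) (dec-true (arc? x y) xy))

  ∈N⁺⁻ : ∀ {x y} → y ∈ N⁺ x → Arc x y
  ∈N⁺⁻ {x} {y} y∈
    with arc? x y | trans (sym (lookup∘tabulate (λ y → does (arc? x y)) y)) ([]=⇒lookup y∈)
  ... | yes xy | _ = xy

  ∈N²⁺ : ∀ {x u y} → Arc x u → Arc u y → ¬ Arc x y → y ∈ N⁺⁺ x
  ∈N²⁺ {x} {u} xu uy ¬xy = x∈p∧x∉q⇒x∈p─q
    (x∈⋃⁺ (∈-map⁺ N⁺ (∈-filter⁺ (arc? x) (∈-allFin u) xu)) (∈N⁺⁺ uy))
    (¬xy ∘ ∈N⁺⁻)

  -- Backward arcs and median orders.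

  backArcs : List (Fin n) → ℕ
  backArcs []       = 0
  backArcs (v ∷ xs) = cnt (arcTo? v) xs + backArcs xs

  backArcs-≤ : ∀ xs → backArcs xs ≤ length xs * length xs
  backArcs-≤ []       = z≤n
  backArcs-≤ (v ∷ xs) = m≤n⇒m≤1+n (+-mono-≤ (length-filter (arcTo? v) xs)
    (≤-trans (backArcs-≤ xs) (*-monoʳ-≤ (length xs) (n≤1+n _))))

  cnt-arc-flip : ∀ v b → cnt (arc? v) [ b ] ≡ cnt (arcTo? b) [ v ]
  cnt-arc-flip v b with does (arc? v b)
  ... | true  = refl
  ... | false = refl

  -- Moving `v` across `B` reverses only the pairs of `v` with entries of `B`: arcs into `v` are
  -- backward when `v` comes first, arcs out of `v` when it comes last. The additive form avoids
  -- subtraction.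
  backArcs-shift : ∀ v B C → backArcs (B ++ v ∷ C) + cnt (arcTo? v) B
                           ≡ backArcs (v ∷ B ++ C) + cnt (arc? v) B
  backArcs-shift v []      C = refl
  backArcs-shift v (b ∷ B) C = begin
    cnt (arcTo? b) (B ++ v ∷ C) + backArcs (B ++ v ∷ C) + cnt (arcTo? v) (b ∷ B)
      ≡⟨ cong₂ (λ k l → k + backArcs (B ++ v ∷ C) + l)
           (trans (cnt-↭ (arcTo? b) (shift v B C)) (cnt-++ (arcTo? b) [ v ] (B ++ C)))
           (cnt-++ (arcTo? v) [ b ] B) ⟩
    (cnt (arcTo? b) [ v ] + cnt (arcTo? b) (B ++ C)) + backArcs (B ++ v ∷ C)
      + (cnt (arcTo? v) [ b ] + cnt (arcTo? v) B)
      ≡⟨ regroup₁ (cnt (arcTo? b) [ v ]) _ _ _ _ ⟩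
    cnt (arcTo? b) [ v ] + cnt (arcTo? b) (B ++ C) + cnt (arcTo? v) [ b ]
      + (backArcs (B ++ v ∷ C) + cnt (arcTo? v) B)
      ≡⟨ cong₂ (λ k l → k + cnt (arcTo? b) (B ++ C) + cnt (arcTo? v) [ b ] + l)
           (sym (cnt-arc-flip v b)) (backArcs-shift v B C) ⟩
    cnt (arc? v) [ b ] + cnt (arcTo? b) (B ++ C) + cnt (arcTo? v) [ b ]
      + (cnt (arcTo? v) (B ++ C) + backArcs (B ++ C) + cnt (arc? v) B)
      ≡⟨ regroup₂ (cnt (arc? v) [ b ]) _ _ _ _ _ ⟩
    (cnt (arcTo? v) [ b ] + cnt (arcTo? v) (B ++ C)) + (cnt (arcTo? b) (B ++ C) + backArcs (B ++ C))
      + (cnt (arc? v) [ b ] + cnt (arc? v) B)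
      ≡⟨ cong₂ (λ k l → k + backArcs (b ∷ B ++ C) + l)
           (cnt-++ (arcTo? v) [ b ] (B ++ C)) (cnt-++ (arc? v) [ b ] B) ⟨
    backArcs (v ∷ b ∷ B ++ C) + cnt (arc? v) (b ∷ B) ∎
    where
    open ≡-Reasoning
    regroup₁ : ∀ p q r s t → (p + q) + r + (s + t) ≡ p + q + s + (r + t)
    regroup₁ = solve-∀
    regroup₂ : ∀ p q s t u w → p + q + s + (t + u + w) ≡ (s + t) + (q + u) + (p + w)
    regroup₂ = solve-∀

  -- Permuting the tail does not change how many of its arcs go back into `A`.
  backArcs-++-< : ∀ A {xs ys} → xs ↭ ys → backArcs xs < backArcs ys →
                  backArcs (A ++ xs) < backArcs (A ++ ys)
  backArcs-++-< []      _   lt = lt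
  backArcs-++-< (a ∷ A) xs↭ys lt =
    +-mono-≤-< (≤-reflexive (cnt-↭ (arcTo? a) (++⁺ˡ A xs↭ys))) (backArcs-++-< A xs↭ys lt)

  backArcs-shift-< : ∀ A v B C → cnt (arcTo? v) B < cnt (arc? v) B →
                     backArcs (A ++ v ∷ B ++ C) < backArcs (A ++ B ++ v ∷ C)
  backArcs-shift-< A v B C lt = backArcs-++-< A (↭-sym (shift v B C))
    (+-cancelʳ-< (cnt (arcTo? v) B) _ _
      (<-≤-trans (+-monoʳ-< (backArcs (v ∷ B ++ C)) lt)
                 (≤-reflexive (sym (backArcs-shift v B C)))))

  -- The feedback property at the first vertex of an interval: a local consequence of maximality
  -- that suffixes inherit.
  MedianOrder : List (Fin n) → Set
  MedianOrder xs = ∀ A v B C → xs ≡ A ++ v ∷ B ++ C → cnt (arc? v) B ≤ cnt (arcTo? v) B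

  median-++⁻ʳ : ∀ A {xs} → MedianOrder (A ++ xs) → MedianOrder xs
  median-++⁻ʳ A m A′ v B C refl = m (A ++ A′) v B C (sym (++-assoc A A′ _))

  -- If no enumeration were median, each could be improved by moving some `v` behind an interval
  -- that violates the inequality, and `backArcs` would outgrow its bound. The double negation
  -- spares deciding `MedianOrder`.
  ¬¬-median-order : ¬ ¬ (∃[ xs ] xs ↭ allFin n × MedianOrder xs)
  ¬¬-median-order none = not-maximal (n * n) (allFin n) ↭-refl (m≤n+m _ _)
    where
    bounded : ∀ {xs} → xs ↭ allFin n → backArcs xs ≤ n * n
    bounded {xs} p = subst (λ k → backArcs xs ≤ k * k)
      (trans (↭-length p) (length-tabulate {n = n} id)) (backArcs-≤ xs)

    -- `k` bounds the room left below `n * n`; each improvement uses up at least one unit.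
    not-maximal : ∀ k xs → xs ↭ allFin n → n * n ≤ backArcs xs + k → ⊥
    not-improvable : ∀ k {b ys} → n * n ≤ b + k → ys ↭ allFin n → b < backArcs ys → ⊥

    not-maximal k xs p le = none (xs , p , λ { A v B C refl → ≮⇒≥ λ lt →
      not-improvable k le (↭-trans (++⁺ˡ A (shift v B C)) p) (backArcs-shift-< A v B C lt) })

    not-improvable zero    {b} le p lt =
      n≮n _ (<-≤-trans lt (≤-trans (bounded p) (subst (n * n ≤_) (+-identityʳ b) le)))
    not-improvable (suc k) {b} {ys} le p lt = not-maximal k ys p
      (≤-trans le (≤-trans (≤-reflexive (+-suc b k)) (+-monoˡ-≤ k lt)))

  -- Bad vertices and the stretches between them.

  module _ (oriented : Oriented D) (quasiTransitive : QuasiTransitive D) (f : Fin n) where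

    Bad : Fin n → Set
    Bad v = Arc v f × v ∉ N⁺⁺ f

    bad? : Decidable Bad
    bad? v = arc? v f ×-dec ¬? (v ∈? N⁺⁺ f)

    -- Holds trivially for `f`, so `f` and the bad vertices can head stretches alike.
    Dominating : Fin n → Set
    Dominating v = (∀ {x} → Arc f x → Arc v x) × (∀ {y} → Arc y v → Arc y f)

    bad⇒dominating : ∀ {v} → Bad v → Dominating v
    bad⇒dominating {v} (vf , v∉) = out , into
      where
      out : ∀ {x} → Arc f x → Arc v x
      out fx with quasiTransitive vf fx (λ { refl → oriented vf fx })
      ... | inj₁ vx = vx
      -- The path `f → x → v` would make `v` a second out-neighbour of `f`.
      ... | inj₂ xv = contradiction (∈N²⁺ fx xv (oriented vf)) v∉
      into : ∀ {y} → Arc y v → Arc y f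
      into yv with quasiTransitive yv vf (λ { refl → oriented vf yv })
      ... | inj₁ yf = yf
      -- By `out`, `f → y` would give `v → y`, against `y → v`.
      ... | inj₂ fy = contradiction yv (oriented (out fy))

    nonBad-stretch : ∀ {v B C} → Dominating v → All (¬_ ∘ Bad) B → MedianOrder (v ∷ B ++ C) →
                     cnt (arc? f) B ≤ cnt (_∈? N⁺⁺ f) B
    nonBad-stretch {v} {B} {C} (out , into) nonBad m = begin
      cnt (arc? f) B       ≤⟨ cnt-mono (arc? f) (arc? v) (All.universal (λ _ → out) B) ⟩
      cnt (arc? v) B       ≤⟨ m [] v B C refl ⟩
      cnt (arcTo? v) B     ≤⟨ cnt-mono (arcTo? v) (_∈? N⁺⁺ f) (All.map second nonBad) ⟩
      cnt (_∈? N⁺⁺ f) B    ∎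
      where
      open ≤-Reasoning
      second : ∀ {y} → ¬ Bad y → Arc y v → y ∈ N⁺⁺ f
      second {y} ¬bad yv = decidable-stable (y ∈? N⁺⁺ f) λ y∉ → ¬bad (into yv , y∉)

    -- Induction on the unread part `C`; `B` accumulates the current stretch behind its head `v`. A
    -- bad vertex closes the stretch and becomes the next head.
    median⇒cnt-≤ : ∀ {v} B C → Dominating v → All (¬_ ∘ Bad) B → MedianOrder (v ∷ B ++ C) →
                   cnt (arc? f) (B ++ C) ≤ cnt (_∈? N⁺⁺ f) (B ++ C)
    median⇒cnt-≤ B [] dom nonBad m rewrite ++-identityʳ B =
      nonBad-stretch dom nonBad (subst (MedianOrder ∘ (_ ∷_)) (sym (++-identityʳ B)) m)
    median⇒cnt-≤ {v} B (x ∷ C) dom nonBad m with bad? x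
    ... | no ¬bad rewrite sym (++-assoc B [ x ] C) =
      median⇒cnt-≤ (B ++ [ x ]) C dom (All-++⁺ nonBad (¬bad ∷ [])) m
    ... | yes bad = begin
      cnt (arc? f) (B ++ x ∷ C)                     ≡⟨ cnt-++ (arc? f) B (x ∷ C) ⟩
      cnt (arc? f) B + cnt (arc? f) (x ∷ C)
        ≡⟨ cong (cnt (arc? f) B +_) (cnt-reject (arc? f) C (oriented (proj₁ bad))) ⟩
      cnt (arc? f) B + cnt (arc? f) C
        ≤⟨ +-mono-≤ (nonBad-stretch dom nonBad m)
             (median⇒cnt-≤ [] C (bad⇒dominating bad) [] (median-++⁻ʳ (v ∷ B) m)) ⟩
      cnt (_∈? N⁺⁺ f) B + cnt (_∈? N⁺⁺ f) C
        ≤⟨ +-monoʳ-≤ (cnt (_∈? N⁺⁺ f) B) (cnt-≤-∷ (_∈? N⁺⁺ f) x C) ⟩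
      cnt (_∈? N⁺⁺ f) B + cnt (_∈? N⁺⁺ f) (x ∷ C)   ≡⟨ cnt-++ (_∈? N⁺⁺ f) B (x ∷ C) ⟨
      cnt (_∈? N⁺⁺ f) (B ++ x ∷ C)                  ∎
      where open ≤-Reasoning

    median-head : ∀ {xs} → f ∷ xs ↭ allFin n → MedianOrder (f ∷ xs) → ∣ N⁺ f ∣ ≤ ∣ N⁺⁺ f ∣
    median-head {xs} p m = begin
      ∣ N⁺ f ∣                        ≡⟨ ∣p∣≡cnt-∈ (N⁺ f) ⟩
      cnt (_∈? N⁺ f) (allFin n)       ≤⟨ cnt-mono (_∈? N⁺ f) (arc? f) (All.universal (λ _ → ∈N⁺⁻) (allFin n)) ⟩
      cnt (arc? f) (allFin n)         ≡⟨ cnt-↭ (arc? f) p ⟨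
      cnt (arc? f) (f ∷ xs)           ≡⟨ cnt-reject (arc? f) xs (no-loop refl) ⟩
      cnt (arc? f) xs                 ≤⟨ median⇒cnt-≤ [] xs (id , id) [] m ⟩
      cnt (_∈? N⁺⁺ f) xs              ≤⟨ cnt-≤-∷ (_∈? N⁺⁺ f) f xs ⟩
      cnt (_∈? N⁺⁺ f) (f ∷ xs)        ≡⟨ cnt-↭ (_∈? N⁺⁺ f) p ⟩
      cnt (_∈? N⁺⁺ f) (allFin n)      ≡⟨ ∣p∣≡cnt-∈ (N⁺⁺ f) ⟨
      ∣ N⁺⁺ f ∣                       ∎
      where open ≤-Reasoning

theorem3p3 : ∀ (n : ℕ) .{{_ : NonZero n}} (D : Digraph n) →
    Oriented D → QuasiTransitive D →
    ∃[ v ] (∣ Digraph.N⁺ D v ∣ ≤ ∣ Digraph.N⁺⁺ D v ∣)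
theorem3p3 n@(suc _) D oriented quasiTransitive =
  -- The claim is decidable by finite search, so a median order that exists only up to double
  -- negation suffices.
  decidable-stable (any? λ v → ∣ Digraph.N⁺ D v ∣ ≤? ∣ Digraph.N⁺⁺ D v ∣) λ none →
    ¬¬-median-order D λ
      -- Since `n` is a successor, the order has a first vertex.
      { ([]     , p , _) → contradiction (↭-length p) λ ()
      ; (f ∷ xs , p , m) → none (f , median-head D oriented quasiTransitive f p m)
      }
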